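{- Let $K$ be a field that is complete with respect to a discrete valuation $v:K\to\mathbb{Z}_{\mathrm{m}0}$, with unit ball $K^\circ=\{x\in K: v(x)\le 1\}$, let $L/K$ be a finite extension of fields, and let $w:L\to\mathbb{Z}_{\mathrm{m}0}$ be the unique discrete valuation on $L$ extending $v$. Then the integral closure of $K^\circ$ in $L$ is equal to the unit ball $\{x\in L: w(x)\le 1\}$, and it is a discrete valuation ring.
   Context: $\mathbb{Z}_{\mathrm{m}0}$ is the linearly ordered commutative group with zero obtained from the multiplicatively written ordered group $\mathbb{Z}$ (elements $\mathrm{of\_add}(n)$, $n\in\mathbb{Z}$, with $\mathrm{of\_add}(a+b)=\mathrm{of\_add}(a)\,\mathrm{of\_add}(b)$, ordered as $\mathbb{Z}$) by adjoining an absorbing smallest element $0$. A valuation on a commutative unitary ring $A$ is a function $v: A\to \mathbb{Z}_{\mathrm{m}0}$ with $v(0)=0$, $v(1)=1$, $v(xy)=v(x)v(y)$ and $v(x+y)\le\max\{v(x),v(y)\}$ for all $x,y$. It is called discrete if it is surjective onto $\mathbb{Z}_{\mathrm{m}0}$. A discrete valuation $w$ on $L$ extends $v$ if there is an integer $e\ge1$ with $w(x)=v(x)^e$ for all $x\in K$; when $K$ is complete and $L/K$ is finite, there is exactly one such $w$. A valuation induces a uniform structure for which the sets $\{x : v(x)\le\gamma\}$, $\gamma\ne 0$, form a basis of neighborhoods of $0$, and completeness refers to this structure. A discrete valuation ring is a local principal ideal domain that is not a field. -}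

module Defs where

open import Algebra.Bundles using (CommutativeRing)
open import Algebra.Bundles.Raw using (RawRing)
import Algebra.Definitions
import Algebra.Definitions.RawMonoid as RawMonoidDefs
import Algebra.Morphism.RingMonomorphism as RingMonomorphism
open import Algebra.Morphism.Structures using (module RingMorphisms)
import Algebra.Properties.Monoid.Sum as Sum
import Algebra.Properties.Ring as RingProperties
import Algebra.Properties.Semiring.Exp as Exp
open import Data.Fin.Base using (toℕ)
open import Data.Integer.Base as ℤ using (ℤ; 0ℤ; +_; -[1+_]; +≤+)
import Data.Integer.Properties as ℤₚ
open import Data.Nat.Base as ℕ using (ℕ; _≥_)
open import Data.Product.Base using (Σ; Σ-syntax; ∃-syntax; _×_; _,_; proj₁; proj₂)
open import Data.Sum.Base using (_⊎_)
open import Data.Vec.Functional using (Vector)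
open import Function.Base using (id)
open import Function.Bundles using (_⇔_)
open import Function.Definitions using (Surjective)
open import Level using (Level; _⊔_; suc; 0ℓ)
open import Relation.Binary.Construct.Add.Infimum.NonStrict ℤ._≤_
  using ([_]; ⊥₋≤_) renaming (_≤₋_ to _≤₀_; ≤₋-trans to ≤₀-trans′)
open import Relation.Binary.PropositionalEquality
  using (_≡_; _≢_; refl; sym; trans; subst)
open import Relation.Nullary.Construct.Add.Infimum using (_₋; ⊥₋; [_])
open import Relation.Nullary.Negation using (¬_)
open import Relation.Unary using (Pred; _∈_; _∉_; _⊆_; _≐_; _∩_; ∅; U)

private
  variable
    a c ℓ c′ ℓ′ p : Level

-- [ n ] is of_add(n), and ⊥₋ is the adjoined 0.

ℤₘ₀ : Set
ℤₘ₀ = ℤ ₋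

infix 4 _≤ₘ_
_≤ₘ_ : ℤₘ₀ → ℤₘ₀ → Set
_≤ₘ_ = _≤₀_

0ₘ 1ₘ : ℤₘ₀
0ₘ = ⊥₋
1ₘ = [ 0ℤ ]

infixl 7 _*ₘ_
_*ₘ_ : ℤₘ₀ → ℤₘ₀ → ℤₘ₀
⊥₋    *ₘ _     = ⊥₋
[ _ ] *ₘ ⊥₋    = ⊥₋
[ m ] *ₘ [ n ] = [ m ℤ.+ n ]

infixr 8 _^ₘ_
_^ₘ_ : ℤₘ₀ → ℕ → ℤₘ₀
γ ^ₘ ℕ.zero  = 1ₘ
γ ^ₘ ℕ.suc n = γ *ₘ γ ^ₘ n

maxₘ : ℤₘ₀ → ℤₘ₀ → ℤₘ₀
maxₘ ⊥₋    δ     = δ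
maxₘ [ m ] ⊥₋    = [ m ]
maxₘ [ m ] [ n ] = [ m ℤ.⊔ n ]

private
  ≤ₘ-trans : ∀ {α β γ} → α ≤ₘ β → β ≤ₘ γ → α ≤ₘ γ
  ≤ₘ-trans = ≤₀-trans′ ℤₚ.≤-trans

  ≤ₘ-reflexive : ∀ {α β} → α ≡ β → α ≤ₘ β
  ≤ₘ-reflexive {⊥₋}    refl = ⊥₋≤ _
  ≤ₘ-reflexive {[ m ]} refl = [ ℤₚ.≤-refl ]

  *ₘ-≤1 : ∀ {α β} → α ≤ₘ 1ₘ → β ≤ₘ 1ₘ → α *ₘ β ≤ₘ 1ₘ
  *ₘ-≤1 (⊥₋≤ _) _       = ⊥₋≤ _
  *ₘ-≤1 [ _ ]   (⊥₋≤ _) = ⊥₋≤ _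
  *ₘ-≤1 [ m≤0 ] [ n≤0 ] = [ ℤₚ.+-mono-≤ m≤0 n≤0 ]

  maxₘ-≤1 : ∀ {α β} → α ≤ₘ 1ₘ → β ≤ₘ 1ₘ → maxₘ α β ≤ₘ 1ₘ
  maxₘ-≤1 (⊥₋≤ _) β≤1     = β≤1
  maxₘ-≤1 [ m≤0 ] (⊥₋≤ _) = [ m≤0 ]
  maxₘ-≤1 [ m≤0 ] [ n≤0 ] = [ ℤₚ.⊔-lub m≤0 n≤0 ]

  square-≤1 : ∀ γ → γ *ₘ γ ≤ₘ 1ₘ → γ ≤ₘ 1ₘ
  square-≤1 ⊥₋                     _          = ⊥₋≤ _
  square-≤1 [ + ℕ.zero ]           _          = [ ℤₚ.≤-refl ]
  square-≤1 [ + (ℕ.suc _) ]        [ +≤+ () ]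
  square-≤1 [ -[1+ _ ] ]           _          = [ ℤ.-≤+ ]

module _ (R : CommutativeRing c ℓ) where
  open CommutativeRing R hiding (refl; sym; trans)
  open Algebra.Definitions _≈_ using (Invertible)
  open RawMonoidDefs *-rawMonoid using (_∣_)

  IsField : Set (c ⊔ ℓ)
  IsField = ¬ (1# ≈ 0#) × (∀ x → ¬ (x ≈ 0#) → Invertible 1# _*_ x)

  IsDomain : Set (c ⊔ ℓ)
  IsDomain = ¬ (1# ≈ 0#) × (∀ x y → x * y ≈ 0# → x ≈ 0# ⊎ y ≈ 0#)

  record IsIdeal (I : Pred Carrier p) : Set (c ⊔ ℓ ⊔ p) where
    field
      resp     : ∀ {x y} → x ≈ y → x ∈ I → y ∈ I
      0∈       : 0# ∈ I
      +-closed : ∀ {x y} → x ∈ I → y ∈ I → x + y ∈ I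
      *-closed : ∀ r {x} → x ∈ I → r * x ∈ I

  IsPrincipal : Pred Carrier p → Set (c ⊔ ℓ ⊔ p)
  IsPrincipal I = ∃[ g ] (∀ x → x ∈ I ⇔ g ∣ x)

  -- Ideals are taken as predicates at the level of g ∣ x, which is where
  -- principal ideals and the set of non-units live.

  IsPrincipalIdealDomain : Set (suc (c ⊔ ℓ))
  IsPrincipalIdealDomain =
    IsDomain × ((I : Pred Carrier (c ⊔ ℓ)) → IsIdeal I → IsPrincipal I)

  record IsMaximalIdeal (M : Pred Carrier (c ⊔ ℓ)) : Set (suc (c ⊔ ℓ)) where
    field
      isIdeal : IsIdeal M
      proper  : 1# ∉ M
      maximal : (J : Pred Carrier (c ⊔ ℓ)) → IsIdeal J → 1# ∉ J → M ⊆ J → J ⊆ M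

  IsLocal : Set (suc (c ⊔ ℓ))
  IsLocal = Σ[ M ∈ Pred Carrier (c ⊔ ℓ) ] IsMaximalIdeal M ×
              ((N : Pred Carrier (c ⊔ ℓ)) → IsMaximalIdeal N → N ≐ M)

  record IsDiscreteValuationRing : Set (suc (c ⊔ ℓ)) where
    field
      isLocal                : IsLocal
      isPrincipalIdealDomain : IsPrincipalIdealDomain
      notField               : ¬ IsField

  record IsSubring (P : Pred Carrier p) : Set (c ⊔ ℓ ⊔ p) where
    field
      resp     : ∀ {x y} → x ≈ y → x ∈ P → y ∈ P
      0∈       : 0# ∈ P
      1∈       : 1# ∈ P
      +-closed : ∀ {x y} → x ∈ P → y ∈ P → x + y ∈ P
      *-closed : ∀ {x y} → x ∈ P → y ∈ P → x * y ∈ P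
      neg-closed : ∀ {x} → x ∈ P → - x ∈ P

  module _ {P : Pred Carrier p} (S : IsSubring P) where
    private
      module S = IsSubring S

      subRawRing : RawRing (c ⊔ p) ℓ
      subRawRing = record
        { Carrier = Σ Carrier P
        ; _≈_     = λ x y → proj₁ x ≈ proj₁ y
        ; _+_     = λ x y → proj₁ x + proj₁ y , S.+-closed (proj₂ x) (proj₂ y)
        ; _*_     = λ x y → proj₁ x * proj₁ y , S.*-closed (proj₂ x) (proj₂ y)
        ; -_      = λ x → - proj₁ x , S.neg-closed (proj₂ x)
        ; 0#      = 0# , S.0∈
        ; 1#      = 1# , S.1∈
        }

      ≈-refl : ∀ {x} → x ≈ x
      ≈-refl = CommutativeRing.refl R

      inclusion : RingMorphisms.IsRingMonomorphism subRawRing rawRing proj₁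
      inclusion = record
        { isRingHomomorphism = record
          { isSemiringHomomorphism = record
            { isNearSemiringHomomorphism = record
              { +-isMonoidHomomorphism = record
                { isMagmaHomomorphism = record
                  { isRelHomomorphism = record { cong = id }
                  ; homo = λ _ _ → ≈-refl
                  }
                ; ε-homo = ≈-refl
                }
              ; *-homo = λ _ _ → ≈-refl
              }
            ; 1#-homo = ≈-refl
            }
          ; -‿homo = λ _ → ≈-refl
          }
        ; injective = id
        }

    subring : CommutativeRing (c ⊔ p) ℓ
    subring = record
      { RawRing subRawRing
      ; isCommutativeRing =
          RingMonomorphism.isCommutativeRing inclusion isCommutativeRing
      }

-- The elements of S that are roots of a monic polynomial
-- Xⁿ + φ(aₙ₋₁) Xⁿ⁻¹ + … + φ(a₀) with coefficients aᵢ in R.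

IntegralClosure : (R : CommutativeRing c ℓ) (S : CommutativeRing c′ ℓ′) →
                  (CommutativeRing.Carrier R → CommutativeRing.Carrier S) →
                  Pred (CommutativeRing.Carrier S) (c ⊔ ℓ′)
IntegralClosure R S φ x =
  Σ[ n ∈ ℕ ] Σ[ a ∈ Vector R.Carrier n ]
    x ^ n + ∑[ i < n ] (φ (a i) * x ^ toℕ i) ≈ 0#
  where
  module R = CommutativeRing R
  open CommutativeRing S
  open Exp semiring using (_^_)
  open Sum +-monoid using (sum-syntax)

record Field c ℓ : Set (suc (c ⊔ ℓ)) where
  field
    commutativeRing : CommutativeRing c ℓ
    isField         : IsField commutativeRing

  open CommutativeRing commutativeRing public

-- A homomorphism of fields ι : K → L makes L an extension of K; it is finite
-- when L is spanned by finitely many elements as a K-vector space.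

module _ (K : Field c ℓ) (L : Field c′ ℓ′) where
  private
    module K = Field K
    module L = Field L
  open Sum L.+-monoid using (sum-syntax)

  record IsFiniteExtension (ι : K.Carrier → L.Carrier) :
         Set (c ⊔ ℓ ⊔ c′ ⊔ ℓ′) where
    field
      isRingHomomorphism :
        RingMorphisms.IsRingHomomorphism K.rawRing L.rawRing ι
      finite : Σ[ n ∈ ℕ ] Σ[ b ∈ Vector L.Carrier n ]
        (∀ y → Σ[ k ∈ Vector K.Carrier n ] y L.≈ ∑[ i < n ] (ι (k i) L.* b i))

-- Subsets are taken at level 0. Under excluded middle every predicate is
-- equivalent to one at level 0, so this is no restriction.

record IsFilter {A : Set a} (F : Pred (Pred A 0ℓ) 0ℓ) : Set (a ⊔ suc 0ℓ) where
  field
    proper : ∅ ∉ F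
    whole  : U ∈ F
    upward : ∀ {S T} → S ⊆ T → S ∈ F → T ∈ F
    inter  : ∀ {S T} → S ∈ F → T ∈ F → S ∩ T ∈ F

module _ (R : CommutativeRing c ℓ) where
  open CommutativeRing R hiding (refl; sym; trans)

  record IsValuation (v : Carrier → ℤₘ₀) : Set (c ⊔ ℓ) where
    field
      v-cong : ∀ {x y} → x ≈ y → v x ≡ v y
      v-0    : v 0# ≡ 0ₘ
      v-1    : v 1# ≡ 1ₘ
      v-*    : ∀ x y → v (x * y) ≡ v x *ₘ v y
      v-+    : ∀ x y → v (x + y) ≤ₘ maxₘ (v x) (v y)

  record IsDiscreteValuation (v : Carrier → ℤₘ₀) : Set (c ⊔ ℓ) where
    field
      isValuation : IsValuation v
      surjective  : Surjective _≈_ _≡_ v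

    open IsValuation isValuation public

  UnitBall : (Carrier → ℤₘ₀) → Pred Carrier 0ℓ
  UnitBall v x = v x ≤ₘ 1ₘ

  unitBall-isSubring : ∀ {v} → IsValuation v → IsSubring R (UnitBall v)
  unitBall-isSubring {v} isV = record
    { resp       = λ x≈y → subst (_≤ₘ 1ₘ) (v-cong x≈y)
    ; 0∈         = ≤ₘ-trans (≤ₘ-reflexive v-0) (⊥₋≤ _)
    ; 1∈         = ≤ₘ-reflexive v-1
    ; +-closed   = λ x∈ y∈ → ≤ₘ-trans (v-+ _ _) (maxₘ-≤1 x∈ y∈)
    ; *-closed   = λ x∈ y∈ → ≤ₘ-trans (≤ₘ-reflexive (v-* _ _)) (*ₘ-≤1 x∈ y∈)
    ; neg-closed = λ {x} x∈ → square-≤1 (v (- x))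
        (≤ₘ-trans (≤ₘ-reflexive (v-neg² x)) (*ₘ-≤1 x∈ x∈))
    }
    where
    open IsValuation isV
    open RingProperties ring using (-‿distribˡ-*; -‿distribʳ-*; -‿involutive)
    module R = CommutativeRing R

    neg² : ∀ x → (- x) * (- x) ≈ x * x
    neg² x = R.trans (R.sym (-‿distribˡ-* x (- x)))
      (R.trans (R.-‿cong (R.sym (-‿distribʳ-* x x))) (-‿involutive (x * x)))

    v-neg² : ∀ x → v (- x) *ₘ v (- x) ≡ v x *ₘ v x
    v-neg² x = trans (sym (v-* _ _)) (trans (v-cong (neg² x)) (v-* _ _))

  unitBallRing : ∀ {v} → IsValuation v → CommutativeRing c ℓ
  unitBallRing isV = subring R (unitBall-isSubring isV)

  -- Completeness of the uniform structure with basic entourages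
  -- {(x , y) : v (x - y) ≤ γ}, γ ≠ 0: every Cauchy filter converges.

  IsCauchy : (Carrier → ℤₘ₀) → Pred (Pred Carrier 0ℓ) 0ℓ → Set (c ⊔ suc 0ℓ)
  IsCauchy v F = ∀ γ → γ ≢ 0ₘ →
    Σ[ S ∈ Pred Carrier 0ℓ ] S ∈ F × (∀ {x y} → x ∈ S → y ∈ S → v (x - y) ≤ₘ γ)

  ConvergesTo : (Carrier → ℤₘ₀) → Pred (Pred Carrier 0ℓ) 0ℓ → Carrier → Set
  ConvergesTo v F l = ∀ γ → γ ≢ 0ₘ → (λ x → v (x - l) ≤ₘ γ) ∈ F

  IsComplete : (Carrier → ℤₘ₀) → Set (c ⊔ suc 0ℓ)
  IsComplete v = (F : Pred (Pred Carrier 0ℓ) 0ℓ) → IsFilter F → IsCauchy v F →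
                 ∃[ l ] ConvergesTo v F l

Extends : {A : Set c} {B : Set c′} → (A → B) → (A → ℤₘ₀) → (B → ℤₘ₀) → Set c
Extends ι v w = ∃[ e ] (e ≥ 1) × (∀ x → w (ι x) ≡ v x ^ₘ e)

{-# OPTIONS --safe #-}

module Submission where

-- The integral equation of x bounds w x by the ultrametric inequality. For the
-- converse, call a subspace V of L proximinal if every element of L has a best
-- approximation in V. If V is proximinal and u is a best approximation to b,
-- then e₀ = b - u is orthogonal to V, that is, w (k e₀ + u′) ≥ w (k e₀), and
-- completeness of K makes V + K b = V + K e₀ proximinal again. Orthogonality
-- also lets the leading coordinate be eliminated, with multipliers in K°, from
-- a sequence in the unit ball, pivoting at a term whose e₀-part has maximal
-- value. By induction on a spanning set of L, every sequence in the unit ball of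
-- L has a term in the K°-span of the preceding ones; for the powers of x with
-- w x ≤ 1 this is an integral equation. In the unit ball, an element of maximal
-- value generates an ideal, and the non-units are the elements of value < 1.

open import Defs
open import Algebra.Bundles using (CommutativeRing)
open import Algebra.Definitions.RawMagma using (_,_)
import Algebra.Definitions.RawMonoid as RawMonoidDefinitions
open import Algebra.Morphism.Structures using (module RingMorphisms)
import Algebra.Properties.AbelianGroup as AbelianGroupProperties
import Algebra.Properties.CommutativeSemigroup as CommutativeSemigroupProperties
import Algebra.Properties.Monoid.Sum as MonoidSum
import Algebra.Properties.Ring as RingProperties
import Algebra.Properties.Semiring.Exp as Exp
import Algebra.Properties.Semiring.Sum as SemiringSum
open import Axiom.ExcludedMiddle using (ExcludedMiddle)
open import Data.Fin.Base as Fin using (Fin; toℕ; fromℕ<)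
open import Data.Fin.Properties using (toℕ<n; toℕ-fromℕ<)
open import Data.Integer.Base as ℤ using (ℤ; 0ℤ; 1ℤ; +_; -[1+_])
import Data.Integer.Properties as ℤₚ
open import Data.Nat.Base as ℕ using (ℕ; s≤s; z≤n)
import Data.Nat.Properties as ℕₚ
open import Data.Product.Base using (Σ-syntax; ∃-syntax; _×_; _,_; proj₁; proj₂)
open import Data.Sum.Base using (_⊎_; inj₁; inj₂)
open import Data.Unit.Base using (tt)
open import Data.Vec.Functional using (Vector; head; tail)
open import Function.Base using (_∘_)
open import Function.Bundles using (mk⇔)
open import Level using (Level; Lift; lift; lower; _⊔_; suc; 0ℓ)
open import Relation.Binary.Construct.Add.Infimum.NonStrict ℤ._≤_
  using ([_]; ⊥₋≤_; [≤]-injective; ≤₋-isTotalOrder-≡)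
open import Relation.Binary.PropositionalEquality using (_≡_; _≢_; refl; sym; trans; cong; subst; subst₂)
import Relation.Binary.Reasoning.Setoid as ≈-Reasoning
open import Relation.Binary.Structures using (IsTotalOrder)
open import Relation.Nullary.Construct.Add.Infimum using (⊥₋; [_])
open import Relation.Nullary.Decidable.Core using (yes; no; True; toWitness; fromWitness; decidable-stable)
open import Relation.Nullary.Negation using (¬_; contradiction)
open import Relation.Unary using (Pred; _∈_; _∉_; _⊆_; _≐_)

private
  variable
    a p : Level

-- Order and arithmetic of `ℤₘ₀`.

open AbelianGroupProperties ℤₚ.+-0-abelianGroup using (//-rightDividesˡ; //-rightDividesʳ)

open IsTotalOrder (≤₋-isTotalOrder-≡ ℤₚ.≤-isTotalOrder) using () renaming
  ( refl to ≤ₘ-refl; reflexive to ≤ₘ-reflexive; trans to ≤ₘ-trans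
  ; total to ≤ₘ-total; antisym to ≤ₘ-antisym)

maxₘ-lub : ∀ {α β γ} → α ≤ₘ γ → β ≤ₘ γ → maxₘ α β ≤ₘ γ
maxₘ-lub (⊥₋≤ _) β≤γ     = β≤γ
maxₘ-lub [ m≤k ] (⊥₋≤ _) = [ m≤k ]
maxₘ-lub [ m≤k ] [ n≤k ] = [ ℤₚ.⊔-lub m≤k n≤k ]

≤0ₘ⇒≡0ₘ : ∀ {α} → α ≤ₘ 0ₘ → α ≡ 0ₘ
≤0ₘ⇒≡0ₘ (⊥₋≤ _) = refl

≰⇒≤pred : ∀ {m γ} → ¬ [ m ] ≤ₘ γ → γ ≤ₘ [ ℤ.pred m ]
≰⇒≤pred {γ = ⊥₋}    m≰γ = ⊥₋≤ _
≰⇒≤pred {γ = [ k ]} m≰k = [ ℤₚ.i<j⇒i≤pred[j] (ℤₚ.≰⇒> (m≰k ∘ [_])) ]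

≰⇒suc≤ : ∀ {m γ} → ¬ γ ≤ₘ [ m ] → [ ℤ.suc m ] ≤ₘ γ
≰⇒suc≤ {γ = ⊥₋}    γ≰m = contradiction (⊥₋≤ _) γ≰m
≰⇒suc≤ {γ = [ k ]} k≰m = [ ℤₚ.i<j⇒suc[i]≤j (ℤₚ.≰⇒> (k≰m ∘ [_])) ]

*ₘ-comm : ∀ α β → α *ₘ β ≡ β *ₘ α
*ₘ-comm ⊥₋    ⊥₋    = refl
*ₘ-comm ⊥₋    [ _ ] = refl
*ₘ-comm [ _ ] ⊥₋    = refl
*ₘ-comm [ m ] [ n ] = cong [_] (ℤₚ.+-comm m n)

*ₘ-identityˡ : ∀ α → 1ₘ *ₘ α ≡ α
*ₘ-identityˡ ⊥₋    = refl
*ₘ-identityˡ [ m ] = cong [_] (ℤₚ.+-identityˡ m)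

*ₘ-identityʳ : ∀ α → α *ₘ 1ₘ ≡ α
*ₘ-identityʳ α = trans (*ₘ-comm α 1ₘ) (*ₘ-identityˡ α)

*ₘ-zeroʳ : ∀ α → α *ₘ 0ₘ ≡ 0ₘ
*ₘ-zeroʳ α = *ₘ-comm α 0ₘ

*ₘ-nonzero : ∀ {α β} → α ≢ 0ₘ → β ≢ 0ₘ → α *ₘ β ≢ 0ₘ
*ₘ-nonzero {⊥₋}            α≢0 _   _ = α≢0 refl
*ₘ-nonzero {[ _ ]} {⊥₋}    _   β≢0 _ = β≢0 refl
*ₘ-nonzero {[ _ ]} {[ _ ]} _   _   ()

*ₘ-mono-≤ : ∀ {α β γ δ} → α ≤ₘ β → γ ≤ₘ δ → α *ₘ γ ≤ₘ β *ₘ δ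
*ₘ-mono-≤ (⊥₋≤ _) _        = ⊥₋≤ _
*ₘ-mono-≤ [ _ ]   (⊥₋≤ _)  = ⊥₋≤ _
*ₘ-mono-≤ [ m≤n ] [ k≤l ] = [ ℤₚ.+-mono-≤ m≤n k≤l ]

*ₘ-cancelʳ-≤ : ∀ {α β} γ → γ ≢ 0ₘ → α *ₘ γ ≤ₘ β *ₘ γ → α ≤ₘ β
*ₘ-cancelʳ-≤                   ⊥₋    γ≢0 _     = contradiction refl γ≢0
*ₘ-cancelʳ-≤ {⊥₋}              [ _ ] _   _     = ⊥₋≤ _
*ₘ-cancelʳ-≤ {[ m ]} {[ n ]}   [ k ] _   [ q ] =
  [ subst₂ ℤ._≤_ (//-rightDividesʳ k m) (//-rightDividesʳ k n) (ℤₚ.+-monoˡ-≤ (ℤ.- k) q) ]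

*ₘ-approx : ∀ {α δ} → δ ≢ 0ₘ → ∃[ γ ] γ ≢ 0ₘ × γ *ₘ α ≤ₘ δ
*ₘ-approx {_}     {⊥₋}    δ≢0 = contradiction refl δ≢0
*ₘ-approx {⊥₋}    {[ _ ]} _   = 1ₘ , (λ ()) , ⊥₋≤ _
*ₘ-approx {[ m ]} {[ d ]} _   = [ d ℤ.- m ] , (λ ()) , [ ℤₚ.≤-reflexive (//-rightDividesˡ m d) ]

^ₘ-mono-≤ : ∀ {α β} n → α ≤ₘ β → α ^ₘ n ≤ₘ β ^ₘ n
^ₘ-mono-≤ ℕ.zero    _   = ≤ₘ-refl
^ₘ-mono-≤ (ℕ.suc n) α≤β = *ₘ-mono-≤ α≤β (^ₘ-mono-≤ n α≤β)

1^ₘ : ∀ n → 1ₘ ^ₘ n ≡ 1ₘ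
1^ₘ ℕ.zero    = refl
1^ₘ (ℕ.suc n) = trans (*ₘ-identityˡ _) (1^ₘ n)

^ₘ-≤1 : ∀ {α} n → α ≤ₘ 1ₘ → α ^ₘ n ≤ₘ 1ₘ
^ₘ-≤1 n α≤1 = ≤ₘ-trans (^ₘ-mono-≤ n α≤1) (≤ₘ-reflexive (1^ₘ n))

[]^ₘ : ∀ m n → [ m ] ^ₘ n ≡ [ + n ℤ.* m ]
[]^ₘ m ℕ.zero    = refl
[]^ₘ m (ℕ.suc n) = trans (cong ([ m ] *ₘ_) ([]^ₘ m n)) (cong [_] (sym (ℤₚ.suc-* (+ n) m)))

^ₘ-nonzero : ∀ {α} n → α ≢ 0ₘ → α ^ₘ n ≢ 0ₘ
^ₘ-nonzero ℕ.zero    _   ()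
^ₘ-nonzero (ℕ.suc n) α≢0 = *ₘ-nonzero α≢0 (^ₘ-nonzero n α≢0)

^ₘ-cancel-≤ : ∀ {α β} n → n ℕ.≥ 1 → α ^ₘ n ≤ₘ β ^ₘ n → α ≤ₘ β
^ₘ-cancel-≤ {⊥₋}            (ℕ.suc n) _ _ = ⊥₋≤ _
^ₘ-cancel-≤ {[ m ]} {⊥₋}    (ℕ.suc n) _ q
  rewrite []^ₘ m n with () ← q
^ₘ-cancel-≤ {[ m ]} {[ k ]} (ℕ.suc n) _ q =
  [ ℤₚ.*-cancelˡ-≤-pos m k (+ ℕ.suc n)
      ([≤]-injective (subst₂ _≤ₘ_ ([]^ₘ m (ℕ.suc n)) ([]^ₘ k (ℕ.suc n)) q)) ]

-- The minimum of `δ` and `1ₘ` serves: one factor is at most `δ` and the remaining ones are at most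
-- `1ₘ`.
^ₘ-approx : ∀ {δ} n → n ℕ.≥ 1 → δ ≢ 0ₘ → ∃[ γ ] γ ≢ 0ₘ × γ ^ₘ n ≤ₘ δ
^ₘ-approx {⊥₋}    _         _ δ≢0 = contradiction refl δ≢0
^ₘ-approx {[ d ]} (ℕ.suc n) _ _   = γ , (λ ()) ,
  ≤ₘ-trans (*ₘ-mono-≤ (≤ₘ-refl {x = γ}) (^ₘ-≤1 n [ ℤₚ.i⊓j≤j d 0ℤ ]))
    (≤ₘ-trans (≤ₘ-reflexive (*ₘ-identityʳ γ)) [ ℤₚ.i⊓j≤i d 0ℤ ])
  where γ = [ d ℤ.⊓ 0ℤ ]

-- A nonzero value would lie below its own predecessor.
all-≤⇒≡0ₘ : ∀ {α} → (∀ γ → γ ≢ 0ₘ → α ≤ₘ γ) → α ≡ 0ₘ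
all-≤⇒≡0ₘ {⊥₋}    _  = refl
all-≤⇒≡0ₘ {[ m ]} ≤γ = contradiction
  (ℤₚ.i≤pred[j]⇒i<j ([≤]-injective (≤γ [ ℤ.pred m ] (λ ())))) (ℤₚ.<-irrefl refl)

-- Attained extrema of functions with values in `ℤₘ₀`.

-∣m∣≤m : ∀ m → ℤ.- (+ ℤ.∣ m ∣) ℤ.≤ m
-∣m∣≤m (+ n)    = ℤₚ.neg-≤-pos {n}
-∣m∣≤m -[1+ n ] = ℤₚ.≤-refl

m≤+∣m∣ : ∀ m → m ℤ.≤ + ℤ.∣ m ∣
m≤+∣m∣ (+ n)    = ℤₚ.≤-refl
m≤+∣m∣ -[1+ n ] = ℤ.-≤+

-- Walk down from `n` until `P` fails, at the latest at 0. This is how the discreteness of ℤ enters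
-- `maximum` and `minimum`.
¬P0∧Pn⇒step : ExcludedMiddle a → (P : Pred ℕ a) → ¬ P 0 → ∀ n → P n → ∃[ m ] ¬ P m × P (ℕ.suc m)
¬P0∧Pn⇒step em P ¬P0 ℕ.zero    Pn = contradiction Pn ¬P0
¬P0∧Pn⇒step em P ¬P0 (ℕ.suc n) Pn with em {P n}
... | yes Pn′ = ¬P0∧Pn⇒step em P ¬P0 n Pn′
... | no ¬Pn′ = n , ¬Pn′ , Pn

-- If no `P n` holds, `f` vanishes everywhere and `x₀` will do; if `P 0` holds, the bound `1ₘ` is
-- attained. Otherwise, at a step from `¬ P m` to `P (suc m)`, every value is at most
-- of_add(-(m+1)), and this bound is reached.
maximum : ExcludedMiddle a → {A : Set a} (f : A → ℤₘ₀) → A → (∀ x → f x ≤ₘ 1ₘ) →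
          ∃[ x ] (∀ y → f y ≤ₘ f x)
maximum {a} em {A} f x₀ f≤1 = result (em {∃[ n ] P n}) (em {P 0})
  where
  P : Pred ℕ a
  P n = ∃[ x ] [ ℤ.- (+ n) ] ≤ₘ f x

  pred-neg : ∀ m → ℤ.pred (ℤ.- (+ m)) ≡ ℤ.- (+ ℕ.suc m)
  pred-neg ℕ.zero    = refl
  pred-neg (ℕ.suc m) = refl

  result : _ → _ → _
  result (no ¬P) _ = x₀ , λ y → below y (f y) refl
    where
    below : ∀ y γ → f y ≡ γ → f y ≤ₘ f x₀
    below y ⊥₋    fy≡ rewrite fy≡ = ⊥₋≤ _
    below y [ m ] fy≡ = contradiction
      (ℤ.∣ m ∣ , y , subst (_ ≤ₘ_) (sym fy≡) [ -∣m∣≤m m ]) ¬P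
  result (yes _) (yes (x , 1≤fx)) = x , λ y → ≤ₘ-trans (f≤1 y) 1≤fx
  result (yes (n , Pn)) (no ¬P0) with ¬P0∧Pn⇒step em P ¬P0 n Pn
  ... | m , ¬Pm , x , ≤fx = x , λ y →
    ≤ₘ-trans (≰⇒≤pred (λ q → ¬Pm (y , q))) (subst (λ k → [ k ] ≤ₘ f x) (sym (pred-neg m)) ≤fx)

-- Dual to `maximum`, with a nonzero lower bound because values could otherwise descend towards 0
-- without attaining a minimum. The value at `x₀` shows that some `P n` holds.
minimum : ExcludedMiddle a → {A : Set a} (f : A → ℤₘ₀) → A → ∀ γ → γ ≢ 0ₘ → (∀ x → ¬ f x ≤ₘ γ) →
          ∃[ x ] (∀ y → f x ≤ₘ f y)
minimum     em     f x₀ ⊥₋    γ≢0 _ = contradiction refl γ≢0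
minimum {a} em {A} f x₀ [ b ] _   f≰b = start (f x₀) refl
  where
  P : Pred ℕ a
  P n = ∃[ x ] f x ≤ₘ [ b ℤ.+ + n ]

  ¬P0 : ¬ P 0
  ¬P0 (x , fx≤) = f≰b x (subst (λ k → f x ≤ₘ [ k ]) (ℤₚ.+-identityʳ b) fx≤)

  suc-+ : ∀ m → b ℤ.+ + ℕ.suc m ≡ ℤ.suc (b ℤ.+ + m)
  suc-+ m = trans (sym (ℤₚ.+-assoc b 1ℤ (+ m)))
    (trans (cong (ℤ._+ + m) (ℤₚ.+-comm b 1ℤ)) (ℤₚ.+-assoc 1ℤ b (+ m)))

  m≤b+∣m-b∣ : ∀ m → m ℤ.≤ b ℤ.+ + ℤ.∣ m ℤ.- b ∣
  m≤b+∣m-b∣ m = subst (λ k → k ℤ.≤ b ℤ.+ + ℤ.∣ m ℤ.- b ∣)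
    (trans (ℤₚ.+-comm b (m ℤ.- b)) (//-rightDividesˡ b m))
    (ℤₚ.+-monoʳ-≤ b (m≤+∣m∣ (m ℤ.- b)))

  start : ∀ γ → f x₀ ≡ γ → ∃[ x ] (∀ y → f x ≤ₘ f y)
  start ⊥₋    fx₀≡ = contradiction (subst (_≤ₘ [ b ]) (sym fx₀≡) (⊥₋≤ _)) (f≰b x₀)
  start [ m ] fx₀≡ with ¬P0∧Pn⇒step em P ¬P0 ℤ.∣ m ℤ.- b ∣
                          (x₀ , subst (_≤ₘ _) (sym fx₀≡) [ m≤b+∣m-b∣ m ])
  ... | k , ¬Pk , x , fx≤ = x , λ y →
    ≤ₘ-trans (subst (λ l → f x ≤ₘ [ l ]) (suc-+ k) fx≤) (≰⇒suc≤ (λ q → ¬Pk (y , q)))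

-- Rearrangements of differences.

module RingIdentities {c ℓ} (R : CommutativeRing c ℓ) where
  open CommutativeRing R renaming (refl to ≈-refl; sym to ≈-sym; trans to ≈-trans)
  open AbelianGroupProperties +-abelianGroup using (⁻¹-∙-comm)
    renaming (//-rightDividesˡ to x-y+y≈x)
  open CommutativeSemigroupProperties +-commutativeSemigroup using (interchange)
  open ≈-Reasoning setoid

  [x+u]-[y+v]≈[x-y]+[u-v] : ∀ x y u v → (x + u) - (y + v) ≈ (x - y) + (u - v)
  [x+u]-[y+v]≈[x-y]+[u-v] x y u v = begin
    (x + u) - (y + v)         ≈⟨ +-congˡ (⁻¹-∙-comm y v) ⟨
    (x + u) + (- y + - v)     ≈⟨ interchange x u (- y) (- v) ⟩
    (x - y) + (u - v)         ∎

  [x+u]-[y+u]≈x-y : ∀ x y u → (x + u) - (y + u) ≈ x - y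
  [x+u]-[y+u]≈x-y x y u = begin
    (x + u) - (y + u) ≈⟨ [x+u]-[y+v]≈[x-y]+[u-v] x y u u ⟩
    (x - y) + (u - u) ≈⟨ +-congˡ (-‿inverseʳ u) ⟩
    (x - y) + 0#      ≈⟨ +-identityʳ _ ⟩
    x - y             ∎

  x-z≈[x-y]+[y-z] : ∀ x y z → x - z ≈ (x - y) + (y - z)
  x-z≈[x-y]+[y-z] x y z = begin
    x - z             ≈⟨ +-congʳ (x-y+y≈x y x) ⟨
    (x - y + y) - z   ≈⟨ +-assoc _ _ _ ⟩
    (x - y) + (y - z) ∎

  x-y-z≈x-[y+z] : ∀ x y z → x - y - z ≈ x - (y + z)
  x-y-z≈x-[y+z] x y z = ≈-trans (+-assoc _ _ _) (+-congˡ (⁻¹-∙-comm y z))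

-- Valued fields.

module ValuedField {c ℓ} (em : ∀ {a} → ExcludedMiddle a) (F : Field c ℓ)
  (w : Field.Carrier F → ℤₘ₀) (isV : IsValuation (Field.commutativeRing F) w) where
  open Field F renaming (refl to ≈-refl; sym to ≈-sym; trans to ≈-trans)
  open IsValuation isV public
  open RingProperties ring using (-1*x≈-x)
  open AbelianGroupProperties +-abelianGroup using (⁻¹-anti-homo‿-)
  open MonoidSum +-monoid using (sum)
  open RingIdentities commutativeRing
  open ≈-Reasoning setoid

  inverse : ∀ {x} → ¬ x ≈ 0# → ∃[ y ] y * x ≈ 1#
  inverse {x} x≉0 = let y , yx≈1 , _ = proj₂ isField x x≉0 in y , yx≈1

  w-≈0 : ∀ {x} → x ≈ 0# → w x ≡ 0ₘ
  w-≈0 x≈0 = trans (v-cong x≈0) v-0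

  w-≈0-≤ : ∀ {x γ} → x ≈ 0# → w x ≤ₘ γ
  w-≈0-≤ x≈0 = subst (_≤ₘ _) (sym (w-≈0 x≈0)) (⊥₋≤ _)

  w-≉0 : ∀ {x} → ¬ x ≈ 0# → w x ≢ 0ₘ
  w-≉0 {x} x≉0 wx≡0 with y , yx≈1 ← inverse x≉0 = absurd
    (trans (sym (*ₘ-zeroʳ (w y))) (trans (cong (w y *ₘ_) (sym wx≡0))
      (trans (sym (v-* y x)) (trans (v-cong yx≈1) v-1))))
    where
    absurd : 0ₘ ≢ 1ₘ
    absurd ()

  w≡0⇒≈0 : ∀ {x} → w x ≡ 0ₘ → x ≈ 0#
  w≡0⇒≈0 {x} wx≡0 = decidable-stable em λ x≉0 → w-≉0 x≉0 wx≡0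

  w-cong-≤ : ∀ {x y γ} → x ≈ y → w x ≤ₘ γ → w y ≤ₘ γ
  w-cong-≤ x≈y = subst (_≤ₘ _) (v-cong x≈y)

  -- The unit ball is a subring, so it contains `- 1#`, and multiplying by `- 1#` cannot raise the
  -- value.
  w[-x]≤w[x] : ∀ x → w (- x) ≤ₘ w x
  w[-x]≤w[x] x = w-cong-≤ (-1*x≈-x x) (subst₂ _≤ₘ_ (sym (v-* (- 1#) x)) (*ₘ-identityˡ (w x))
    (*ₘ-mono-≤ (neg-closed 1∈) (≤ₘ-refl {x = w x})))
    where open IsSubring (unitBall-isSubring commutativeRing isV)

  w[x-y]≤w[y-x] : ∀ x y → w (x - y) ≤ₘ w (y - x)
  w[x-y]≤w[y-x] x y = w-cong-≤ (⁻¹-anti-homo‿- y x) (w[-x]≤w[x] (y - x))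

  w-+-≤ : ∀ {x y γ} → w x ≤ₘ γ → w y ≤ₘ γ → w (x + y) ≤ₘ γ
  w-+-≤ wx≤ wy≤ = ≤ₘ-trans (v-+ _ _) (maxₘ-lub wx≤ wy≤)

  w-triangle : ∀ {x y z γ} → w (x - y) ≤ₘ γ → w (y - z) ≤ₘ γ → w (x - z) ≤ₘ γ
  w-triangle {x} {y} {z} wxy≤ wyz≤ = w-cong-≤ (≈-sym (x-z≈[x-y]+[y-z] x y z)) (w-+-≤ wxy≤ wyz≤)

  w-*-≤1 : ∀ {x y} → w x ≤ₘ 1ₘ → w y ≤ₘ 1ₘ → w (x * y) ≤ₘ 1ₘ
  w-*-≤1 wx≤1 wy≤1 = subst (_≤ₘ 1ₘ) (sym (v-* _ _)) (*ₘ-mono-≤ wx≤1 wy≤1)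

  w-sum-≤ : ∀ {n} (f : Vector Carrier n) {γ} → (∀ i → w (f i) ≤ₘ γ) → w (sum f) ≤ₘ γ
  w-sum-≤ {ℕ.zero}  f f≤ = w-≈0-≤ ≈-refl
  w-sum-≤ {ℕ.suc n} f f≤ = w-+-≤ (f≤ Fin.zero) (w-sum-≤ (tail f) (f≤ ∘ Fin.suc))

  -- The quotient is `x * y⁻¹`; if `y` is zero then so is `x`, and `0#` serves. It yields generators
  -- of ideals in the unit ball and the multipliers of the elimination.
  ≤⇒divides : ∀ {x y} → w x ≤ₘ w y → ∃[ q ] w q ≤ₘ 1ₘ × x ≈ q * y
  ≤⇒divides {x} {y} wx≤wy with em {P = y ≈ 0#}
  ... | yes y≈0 = 0# , w-≈0-≤ ≈-refl ,
    ≈-trans (w≡0⇒≈0 (≤0ₘ⇒≡0ₘ (subst (w x ≤ₘ_) (w-≈0 y≈0) wx≤wy))) (≈-sym (zeroˡ y))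
  ... | no y≉0 with y⁻¹ , y⁻¹y≈1 ← inverse y≉0 = x * y⁻¹ ,
    *ₘ-cancelʳ-≤ (w y) (w-≉0 y≉0)
      (subst₂ _≤ₘ_ (trans (v-cong x≈) (v-* _ _)) (sym (*ₘ-identityˡ (w y))) wx≤wy) , x≈
    where
    x≈ : x ≈ x * y⁻¹ * y
    x≈ = begin
      x             ≈⟨ *-identityʳ x ⟨
      x * 1#        ≈⟨ *-congˡ y⁻¹y≈1 ⟨
      x * (y⁻¹ * y) ≈⟨ *-assoc x y⁻¹ y ⟨
      x * y⁻¹ * y   ∎

-- The unit ball as a discrete valuation ring.

module DiscreteValuationRing {c ℓ p} (em : ∀ {a} → ExcludedMiddle a) (F : Field c ℓ)
  (w : Field.Carrier F → ℤₘ₀) (discrete : IsDiscreteValuation (Field.commutativeRing F) w)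
  {I : Pred (Field.Carrier F) p} (I≐ball : I ≐ UnitBall (Field.commutativeRing F) w)
  (isSubring : IsSubring (Field.commutativeRing F) I) where
  open Field F renaming (refl to ≈-refl; sym to ≈-sym; trans to ≈-trans)
  open ValuedField em F w (IsDiscreteValuation.isValuation discrete)

  -- The carrier is any predicate equivalent to the unit ball, so that the results apply directly to
  -- the integral closure.
  ring° : CommutativeRing (c ⊔ p) ℓ
  ring° = subring commutativeRing isSubring

  private
    module F° = CommutativeRing ring°
  open RawMonoidDefinitions F°.*-rawMonoid using (_∣_)

  w≤1 : (x : F°.Carrier) → w (proj₁ x) ≤ₘ 1ₘ
  w≤1 (_ , x∈I) = proj₁ I≐ball x∈I

  ball : ∀ x → w x ≤ₘ 1ₘ → F°.Carrier
  ball x wx≤1 = x , proj₂ I≐ball wx≤1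

  isDomain : IsDomain ring°
  isDomain = proj₁ isField , λ { (x , _) (y , _) xy≈0 →
      zero-factor x y xy≈0 (em {P = x ≈ 0#}) (em {P = y ≈ 0#}) }
    where
    zero-factor : ∀ x y → x * y ≈ 0# → _ → _ → x ≈ 0# ⊎ y ≈ 0#
    zero-factor x y _    (yes x≈0) _         = inj₁ x≈0
    zero-factor x y _    (no _)    (yes y≈0) = inj₂ y≈0
    zero-factor x y xy≈0 (no x≉0)  (no y≉0)  = contradiction
      (trans (sym (v-* x y)) (w-≈0 xy≈0)) (*ₘ-nonzero (w-≉0 x≉0) (w-≉0 y≉0))

  -- Values on `J` are at most `1ₘ`, so a largest one is attained; its element divides all others by
  -- `≤⇒divides`.
  ideal⇒principal : (J : Pred F°.Carrier (c ⊔ p ⊔ ℓ)) → IsIdeal ring° J → IsPrincipal ring° J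
  ideal⇒principal J isIdeal = g , λ x → mk⇔ (J⇒g∣ x) λ { (q , qg≈x) → resp qg≈x (*-closed q g∈J) }
    where
    open IsIdeal isIdeal
    generator = maximum em {Σ[ x ∈ F°.Carrier ] J x} (w ∘ proj₁ ∘ proj₁) (F°.0# , 0∈) (w≤1 ∘ proj₁)
    g = proj₁ (proj₁ generator)
    g∈J = proj₂ (proj₁ generator)

    J⇒g∣ : ∀ x → J x → g ∣ x
    J⇒g∣ x x∈J with q , wq≤1 , x≈qg ← ≤⇒divides (proj₂ generator (x , x∈J)) =
      ball q wq≤1 , ≈-sym x≈qg

  -- Inside the ball, a value other than `1ₘ` is a value below it. `Lift` raises the predicate to
  -- the level at which ideals are taken.
  M : Pred F°.Carrier (c ⊔ p ⊔ ℓ)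
  M x = Lift _ (w (proj₁ x) ≢ 1ₘ)

  -- of_add(-1) is the largest value below `1ₘ`; this turns the strict bound into a weak one, to
  -- which the ultrametric inequality applies.
  M⇒w<1 : ∀ {x} → M x → w (proj₁ x) ≤ₘ [ -[1+ 0 ] ]
  M⇒w<1 {x} (lift wx≢1) = ≰⇒≤pred (λ 1≤wx → wx≢1 (≤ₘ-antisym (w≤1 x) 1≤wx))

  w<1⇒M : ∀ {x} → w (proj₁ x) ≤ₘ [ -[1+ 0 ] ] → M x
  w<1⇒M w<1 = lift λ w≡1 → contradiction (subst (_≤ₘ [ -[1+ 0 ] ]) w≡1 w<1) λ { [ () ] }

  M-isIdeal : IsIdeal ring° M
  M-isIdeal = record
    { resp     = λ x≈y (lift wx≢1) → lift (λ wy≡1 → wx≢1 (trans (v-cong x≈y) wy≡1))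
    ; 0∈       = w<1⇒M {F°.0#} (w-≈0-≤ ≈-refl)
    ; +-closed = λ {x} {y} x∈M y∈M → w<1⇒M {x F°.+ y} (w-+-≤ (M⇒w<1 {x} x∈M) (M⇒w<1 {y} y∈M))
    ; *-closed = λ r {x} x∈M → w<1⇒M {r F°.* x} (subst (_≤ₘ _) (sym (v-* _ _))
                   (*ₘ-mono-≤ (w≤1 r) (M⇒w<1 {x} x∈M)))
    }

  -- An element of value `1ₘ` divides `1#`, so a proper ideal contains none. Both the maximality of
  -- `M` and its uniqueness follow.
  proper⇒⊆M : (J : Pred F°.Carrier (c ⊔ p ⊔ ℓ)) → IsIdeal ring° J → F°.1# ∉ J → J ⊆ M
  proper⇒⊆M J isIdeal 1∉J {x} x∈J = lift λ wx≡1 →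
    let q , wq≤1 , 1≈qx = ≤⇒divides (≤ₘ-reflexive (trans v-1 (sym wx≡1)))
    in 1∉J (resp (≈-sym 1≈qx) (*-closed (ball q wq≤1) x∈J))
    where open IsIdeal isIdeal

  M-isMaximalIdeal : IsMaximalIdeal ring° M
  M-isMaximalIdeal = record
    { isIdeal = M-isIdeal
    ; proper  = λ (lift w1≢1) → w1≢1 v-1
    ; maximal = λ J isIdeal 1∉J _ → proper⇒⊆M J isIdeal 1∉J
    }

  isLocal : IsLocal ring°
  isLocal = M , M-isMaximalIdeal , λ N isMaximal →
    let open IsMaximalIdeal isMaximal
        N⊆M = λ {x} → proper⇒⊆M N isIdeal proper {x}
    in N⊆M , maximal M M-isIdeal (IsMaximalIdeal.proper M-isMaximalIdeal) N⊆M

  notField : ¬ IsField ring°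
  -- Here `u` is a uniformizer; an inverse of it inside the ball would give `1ₘ` at most of_add(-1).
  notField (_ , invert) with u , u↦ ← IsDiscreteValuation.surjective discrete [ -[1+ 0 ] ]
    with wu≡ ← u↦ ≈-refl
    with u⁻¹ , u⁻¹u≈1 , _ ← invert (ball u (subst (_≤ₘ 1ₘ) (sym wu≡) [ ℤ.-≤+ ]))
                              (λ u≈0 → contradiction (trans (sym wu≡) (w-≈0 u≈0)) λ ())
    = contradiction
      (subst₂ _≤ₘ_ (trans (cong (w (proj₁ u⁻¹) *ₘ_) (sym wu≡))
          (trans (sym (v-* _ _)) (trans (v-cong u⁻¹u≈1) v-1)))
        (*ₘ-identityˡ [ -[1+ 0 ] ]) (*ₘ-mono-≤ (w≤1 u⁻¹) (≤ₘ-refl {x = [ -[1+ 0 ] ]})))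
      λ { [ () ] }

  isDiscreteValuationRing : IsDiscreteValuationRing ring°
  isDiscreteValuationRing = record
    { isLocal                = isLocal
    ; isPrincipalIdealDomain = isDomain , ideal⇒principal
    ; notField               = notField
    }

-- Integral elements of a valued extension.

module FiniteExtension {c ℓ c′ ℓ′} (em : ∀ {a} → ExcludedMiddle a)
  (K : Field c ℓ) (L : Field c′ ℓ′) (v : Field.Carrier K → ℤₘ₀)
  (v-isV : IsValuation (Field.commutativeRing K) v) (complete : IsComplete (Field.commutativeRing K) v)
  (ι : Field.Carrier K → Field.Carrier L)
  (ι-hom : RingMorphisms.IsRingHomomorphism (Field.rawRing K) (Field.rawRing L) ι)
  (w : Field.Carrier L → ℤₘ₀) (w-isV : IsValuation (Field.commutativeRing L) w)
  (e : ℕ) (e≥1 : e ℕ.≥ 1) (w-ι : ∀ x → w (ι x) ≡ v x ^ₘ e) where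

  private
    module K = Field K
    module KV = ValuedField em K v v-isV
    module ι = RingMorphisms.IsRingHomomorphism ι-hom
  open Field L renaming (refl to ≈-refl; sym to ≈-sym; trans to ≈-trans)
  open ValuedField em L w w-isV
  open RingProperties ring using (-‿distribˡ-*; -‿involutive; [y-z]x≈yx-zx)
  open AbelianGroupProperties +-abelianGroup using ()
    renaming (//-rightDividesˡ to x-y+y≈x; //-rightDividesʳ to x+y-y≈x; inverseˡ-unique to x+y≈0⇒x≈-y)
  open CommutativeSemigroupProperties +-commutativeSemigroup using (interchange)
  open RingIdentities commutativeRing
  open SemiringSum semiring using (sum; sum-cong-≋; sum-replicate-zero; ∑-distrib-+; *-distribˡ-sum)
  open Exp semiring using (_^_)
  open ≈-Reasoning setoid

  v≤1⇒wι≤1 : ∀ {k} → v k ≤ₘ 1ₘ → w (ι k) ≤ₘ 1ₘ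
  v≤1⇒wι≤1 {k} vk≤1 = subst (_≤ₘ 1ₘ) (sym (w-ι k)) (^ₘ-≤1 e vk≤1)

  ι[k-k′]x≈ : ∀ k k′ x → ι (k K.- k′) * x ≈ ι k * x - ι k′ * x
  ι[k-k′]x≈ k k′ x = begin
    ι (k K.- k′) * x    ≈⟨ *-congʳ (≈-trans (ι.+-homo k (K.- k′)) (+-congˡ (ι.-‿homo k′))) ⟩
    (ι k - ι k′) * x    ≈⟨ [y-z]x≈yx-zx x (ι k) (ι k′) ⟩
    ι k * x - ι k′ * x  ∎

  -- If `w x` is at least `1ₘ`, every lower term of the equation has value at most that of `x ^ n`.
  -- Hence so has `x ^ suc n`, and cancelling `w (x ^ n)` bounds `w x`.
  integral⇒w≤1 : ∀ x → (n : ℕ) (k : Vector K.Carrier n) → (∀ i → v (k i) ≤ₘ 1ₘ) →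
                 x ^ n + sum (λ i → ι (k i) * x ^ toℕ i) ≈ 0# → w x ≤ₘ 1ₘ
  -- In degree 0 the equation reads `1# ≈ 0#`.
  integral⇒w≤1 x ℕ.zero    k vk≤1 eq = contradiction (≈-trans (≈-sym (+-identityʳ 1#)) eq) (proj₁ isField)
  integral⇒w≤1 x (ℕ.suc n) k vk≤1 eq with ≤ₘ-total (w x) 1ₘ
  ... | inj₁ wx≤1 = wx≤1
  ... | inj₂ 1≤wx = *ₘ-cancelʳ-≤ (w (x ^ n)) (λ wxⁿ≡0 → 1≰0 (subst (1ₘ ≤ₘ_) wxⁿ≡0 (1≤w^ n)))
      (subst₂ _≤ₘ_ (v-* x (x ^ n)) (sym (*ₘ-identityˡ _))
        (w-cong-≤ (≈-sym (x+y≈0⇒x≈-y _ _ eq)) (≤ₘ-trans (w[-x]≤w[x] _) (w-sum-≤ _ terms≤))))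
    where
    1≰0 : ¬ 1ₘ ≤ₘ 0ₘ
    1≰0 ()

    w^-mono : ∀ {i j} → i ℕ.≤ j → w (x ^ i) ≤ₘ w (x ^ j)
    w^-mono {j = j} z≤n = subst (_≤ₘ w (x ^ j)) (sym v-1) (1≤ j)
      where
      1≤ : ∀ j → 1ₘ ≤ₘ w (x ^ j)
      1≤ ℕ.zero    = ≤ₘ-reflexive (sym v-1)
      1≤ (ℕ.suc j) = subst (1ₘ ≤ₘ_) (sym (v-* x (x ^ j))) (*ₘ-mono-≤ 1≤wx (1≤ j))
    w^-mono (s≤s i≤j) = subst₂ _≤ₘ_ (sym (v-* x _)) (sym (v-* x _))
      (*ₘ-mono-≤ (≤ₘ-refl {x = w x}) (w^-mono i≤j))

    1≤w^ : ∀ n → 1ₘ ≤ₘ w (x ^ n)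
    1≤w^ n = subst (_≤ₘ w (x ^ n)) v-1 (w^-mono {0} {n} z≤n)

    terms≤ : ∀ i → w (ι (k i) * x ^ toℕ i) ≤ₘ w (x ^ n)
    terms≤ i = subst₂ _≤ₘ_ (sym (v-* _ _)) (*ₘ-identityˡ _)
      (*ₘ-mono-≤ (v≤1⇒wι≤1 (vk≤1 i)) (w^-mono (ℕₚ.≤-pred (toℕ<n i))))

  ι[-1]x≈-x : ∀ x → ι (K.- K.1#) * x ≈ - x
  ι[-1]x≈-x x = begin
    ι (K.- K.1#) * x ≈⟨ *-congʳ (≈-trans (ι.-‿homo K.1#) (-‿cong ι.1#-homo)) ⟩
    - 1# * x         ≈⟨ -‿distribˡ-* 1# x ⟨
    - (1# * x)       ≈⟨ -‿cong (*-identityˡ x) ⟩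
    - x              ∎

  -- Subspaces over `K`, submodules over `K°`, and best approximation.

  record IsSubspace (V : Pred Carrier a) : Set (a ⊔ c ⊔ c′ ⊔ ℓ′) where
    field
      resp     : ∀ {x y} → x ≈ y → V x → V y
      0∈       : V 0#
      +-closed : ∀ {x y} → V x → V y → V (x + y)
      ι-closed : ∀ k {x} → V x → V (ι k * x)

    neg-closed : ∀ {x} → V x → V (- x)
    neg-closed {x} x∈V = resp (ι[-1]x≈-x x) (ι-closed (K.- K.1#) x∈V)

  record IsSubmodule (S : Pred Carrier a) : Set (a ⊔ c ⊔ c′ ⊔ ℓ′) where
    field
      resp     : ∀ {x y} → x ≈ y → S x → S y
      0∈       : S 0#
      +-closed : ∀ {x y} → S x → S y → S (x + y)
      ι-closed : ∀ k {x} → v k ≤ₘ 1ₘ → S x → S (ι k * x)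

  BestApproximation : Pred Carrier a → Carrier → Pred Carrier (a ⊔ c′)
  BestApproximation V x u = V u × (∀ {u′} → V u′ → w (x - u) ≤ₘ w (x - u′))

  Proximinal : Pred Carrier a → Set (a ⊔ c′)
  Proximinal V = ∀ x → ∃[ u ] BestApproximation V x u

  -- Finite generation of the K°-submodules of the unit ball of V, stated so that
  -- y n = x ^ n gives an integral equation for x.
  Noetherian : Pred Carrier a → Set (a ⊔ suc c ⊔ c′ ⊔ suc ℓ′)
  Noetherian V = (y : ℕ → Carrier) → (∀ n → V (y n)) → (∀ n → w (y n) ≤ₘ 1ₘ) →
    ∃[ n ] ((S : Pred Carrier (c ⊔ ℓ′)) → IsSubmodule S → (∀ i → i ℕ.< n → S (y i)) → S (y n))

  -- Adjoining a vector orthogonal to a subspace.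

  module Adjoin {V : Pred Carrier (c ⊔ c′ ⊔ ℓ′)} (subspace : IsSubspace V)
    (proximinal : Proximinal V) (noetherian : Noetherian V)
    (e₀ : Carrier) (e₀⊥V : ∀ {u} → V u → w e₀ ≤ₘ w (e₀ + u)) where
    open IsSubspace subspace

    V+Ke₀ : Pred Carrier (c ⊔ c′ ⊔ ℓ′)
    V+Ke₀ x = Σ[ k ∈ K.Carrier ] Σ[ u ∈ Carrier ] V u × x ≈ ι k * e₀ + u

    V⊆V+Ke₀ : V ⊆ V+Ke₀
    V⊆V+Ke₀ {u} u∈V = K.0# , u , u∈V , (begin
      u               ≈⟨ +-identityˡ u ⟨
      0# + u          ≈⟨ +-congʳ (zeroˡ e₀) ⟨
      0# * e₀ + u     ≈⟨ +-congʳ (*-congʳ ι.0#-homo) ⟨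
      ι K.0# * e₀ + u ∎)

    V+Ke₀-isSubspace : IsSubspace V+Ke₀
    V+Ke₀-isSubspace = record
      { resp     = λ { x≈y (k , u , u∈V , x≈) → k , u , u∈V , ≈-trans (≈-sym x≈y) x≈ }
      ; 0∈       = V⊆V+Ke₀ 0∈
      ; +-closed = λ { (k , u , u∈V , x≈) (k′ , u′ , u′∈V , x′≈) →
          k K.+ k′ , u + u′ , +-closed u∈V u′∈V , ≈-trans (+-cong x≈ x′≈) (sum-≈ k u k′ u′) }
      ; ι-closed = λ { q (k , u , u∈V , x≈) →
          q K.* k , ι q * u , ι-closed q u∈V , ≈-trans (*-congˡ x≈) (scale-≈ q k u) }
      }
      where
      sum-≈ : ∀ k u k′ u′ → (ι k * e₀ + u) + (ι k′ * e₀ + u′) ≈ ι (k K.+ k′) * e₀ + (u + u′)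
      sum-≈ k u k′ u′ = begin
        (ι k * e₀ + u) + (ι k′ * e₀ + u′) ≈⟨ interchange _ _ _ _ ⟩
        (ι k * e₀ + ι k′ * e₀) + (u + u′) ≈⟨ +-congʳ (distribʳ e₀ (ι k) (ι k′)) ⟨
        (ι k + ι k′) * e₀ + (u + u′)      ≈⟨ +-congʳ (*-congʳ (ι.+-homo k k′)) ⟨
        ι (k K.+ k′) * e₀ + (u + u′)      ∎
      scale-≈ : ∀ q k u → ι q * (ι k * e₀ + u) ≈ ι (q K.* k) * e₀ + ι q * u
      scale-≈ q k u = begin
        ι q * (ι k * e₀ + u)       ≈⟨ distribˡ (ι q) _ _ ⟩
        ι q * (ι k * e₀) + ι q * u ≈⟨ +-congʳ (*-assoc (ι q) (ι k) e₀) ⟨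
        ι q * ι k * e₀ + ι q * u   ≈⟨ +-congʳ (*-congʳ (ι.*-homo q k)) ⟨
        ι (q K.* k) * e₀ + ι q * u ∎

    -- For nonzero `k`, factor out `ι k` and apply `e₀⊥V` to `ι k⁻¹ * u`.
    orthogonal : ∀ k {u} → V u → w (ι k * e₀) ≤ₘ w (ι k * e₀ + u)
    orthogonal k {u} u∈V with em {P = k K.≈ K.0#}
    ... | yes k≈0 = w-≈0-≤ (≈-trans (*-congʳ (≈-trans (ι.⟦⟧-cong k≈0) ι.0#-homo)) (zeroˡ e₀))
    ... | no k≉0 with k⁻¹ , k⁻¹k≈1 ← KV.inverse k≉0 =
      subst₂ _≤ₘ_ (sym (v-* (ι k) e₀)) (trans (sym (v-* (ι k) _)) (v-cong factor))
        (*ₘ-mono-≤ (≤ₘ-refl {x = w (ι k)}) (e₀⊥V (ι-closed k⁻¹ u∈V)))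
      where
      factor : ι k * (e₀ + ι k⁻¹ * u) ≈ ι k * e₀ + u
      factor = begin
        ι k * (e₀ + ι k⁻¹ * u)         ≈⟨ distribˡ (ι k) e₀ _ ⟩
        ι k * e₀ + ι k * (ι k⁻¹ * u)   ≈⟨ +-congˡ (*-assoc (ι k) (ι k⁻¹) u) ⟨
        ι k * e₀ + ι k * ι k⁻¹ * u     ≈⟨ +-congˡ (*-congʳ (*-comm (ι k) (ι k⁻¹))) ⟩
        ι k * e₀ + ι k⁻¹ * ι k * u     ≈⟨ +-congˡ (*-congʳ (ι.*-homo k⁻¹ k)) ⟨
        ι k * e₀ + ι (k⁻¹ K.* k) * u   ≈⟨ +-congˡ (*-congʳ (≈-trans (ι.⟦⟧-cong k⁻¹k≈1) ι.1#-homo)) ⟩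
        ι k * e₀ + 1# * u              ≈⟨ +-congˡ (*-identityˡ u) ⟩
        ι k * e₀ + u                   ∎

    -- This settles the degenerate case separately, since the main arguments cancel `w e₀`.
    e₀≈0⇒V+Ke₀⊆V : e₀ ≈ 0# → V+Ke₀ ⊆ V
    e₀≈0⇒V+Ke₀⊆V e₀≈0 {x} (k , u , u∈V , x≈) = resp (≈-sym x≈u) u∈V
      where
      x≈u : x ≈ u
      x≈u = begin
        x            ≈⟨ x≈ ⟩
        ι k * e₀ + u ≈⟨ +-congʳ (≈-trans (*-congˡ e₀≈0) (zeroʳ (ι k))) ⟩
        0# + u       ≈⟨ +-identityˡ u ⟩
        u            ∎

    -- Orthogonality applied to a difference of two vectors: close vectors have close
    -- `e₀`-coordinates.
    coordinate-≤ : ∀ {k k′ u u′} → V u → V u′ →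
      w (ι (k K.- k′) * e₀) ≤ₘ w ((ι k * e₀ + u) - (ι k′ * e₀ + u′))
    coordinate-≤ {k} {k′} {u} {u′} u∈V u′∈V =
      ≤ₘ-trans (orthogonal (k K.- k′) (+-closed u∈V (neg-closed u′∈V))) (≤ₘ-reflexive (v-cong (begin
        ι (k K.- k′) * e₀ + (u - u′)          ≈⟨ +-congʳ (ι[k-k′]x≈ k k′ e₀) ⟩
        (ι k * e₀ - ι k′ * e₀) + (u - u′)     ≈⟨ [x+u]-[y+v]≈[x-y]+[u-v] _ _ _ _ ⟨
        (ι k * e₀ + u) - (ι k′ * e₀ + u′)     ∎)))

    -- Orthogonality of e₀ to V makes the e₀-coordinates of better and better
    -- approximations ι k * e₀ + u to x a Cauchy filter on K.
    module Limit (e₀≉0 : ¬ e₀ ≈ 0#) (x : Carrier)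
      (approximable : ∀ γ → γ ≢ 0ₘ → ∃[ z ] V+Ke₀ z × w (x - z) ≤ₘ γ) where

      Near : ℤₘ₀ → K.Carrier → Carrier → Set
      Near γ k u = w (x - (ι k * e₀ + u)) ≤ₘ γ

      -- Membership in the filter generated by the sets of `e₀`-coordinates of all approximations to
      -- `x` within `γ`.
      Eventually : Pred K.Carrier 0ℓ → Set (c ⊔ c′ ⊔ ℓ′)
      Eventually S = ∃[ γ ] γ ≢ 0ₘ × (∀ {k u} → V u → Near γ k u → S k)

      -- By excluded middle every proposition has an equivalent at level 0, where
      -- the sets of 𝓕 and 𝓕 itself have to live.
      ⌊_⌋ : Set a → Set
      ⌊ P ⌋ = True (em {P = P})

      𝓕 : Pred (Pred K.Carrier 0ℓ) 0ℓ
      𝓕 S = ⌊ Eventually S ⌋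

      near : ∀ γ → γ ≢ 0ₘ → ∃[ k ] ∃[ u ] V u × Near γ k u
      near γ γ≢0 with z , (k , u , u∈V , z≈) , x-z≤γ ← approximable γ γ≢0 =
        k , u , u∈V , w-cong-≤ (+-congˡ (-‿cong z≈)) x-z≤γ

      common : ∀ {γ δ} → γ ≢ 0ₘ → δ ≢ 0ₘ → ∃[ ε ] ε ≢ 0ₘ × ε ≤ₘ γ × ε ≤ₘ δ
      common {γ} {δ} γ≢0 δ≢0 with ≤ₘ-total γ δ
      ... | inj₁ γ≤δ = γ , γ≢0 , ≤ₘ-refl , γ≤δ
      ... | inj₂ δ≤γ = δ , δ≢0 , δ≤γ , ≤ₘ-refl

      𝓕-isFilter : IsFilter 𝓕
      𝓕-isFilter = record
        { proper = λ ∅∈𝓕 → let γ , γ≢0 , absurd = toWitness ∅∈𝓕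
                               k , u , u∈V , k-near = near γ γ≢0
                           in absurd u∈V k-near
        ; whole  = fromWitness (1ₘ , (λ ()) , λ _ _ → tt)
        ; upward = λ S⊆T S∈𝓕 → let γ , γ≢0 , f = toWitness S∈𝓕
                               in fromWitness (γ , γ≢0 , λ u∈V k-near → S⊆T (f u∈V k-near))
        ; inter  = λ S∈𝓕 T∈𝓕 →
            let γ , γ≢0 , f = toWitness S∈𝓕
                δ , δ≢0 , g = toWitness T∈𝓕
                ε , ε≢0 , ε≤γ , ε≤δ = common γ≢0 δ≢0
            in fromWitness (ε , ε≢0 , λ u∈V k-near →
                 f u∈V (≤ₘ-trans k-near ε≤γ) , g u∈V (≤ₘ-trans k-near ε≤δ))
        }

      𝓕-isCauchy : IsCauchy K.commutativeRing v 𝓕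
      𝓕-isCauchy γ γ≢0 = S , fromWitness (δ , δ≢0 , λ u∈V k-near → fromWitness (_ , u∈V , k-near)) ,
        λ k∈S k′∈S → close (toWitness k∈S) (toWitness k′∈S)
        where
        -- Chosen so that `coordinate-≤` gives `v (k - k′) ^ₘ e *ₘ w e₀` at most `γ ^ₘ e *ₘ w e₀`;
        -- then `w e₀` and the exponent `e` cancel.
        δ = γ ^ₘ e *ₘ w e₀
        δ≢0 = *ₘ-nonzero (^ₘ-nonzero e γ≢0) (w-≉0 e₀≉0)

        S : Pred K.Carrier 0ℓ
        S k = ⌊ (∃[ u ] V u × Near δ k u) ⌋

        close : ∀ {k k′} → ∃[ u ] V u × Near δ k u → ∃[ u ] V u × Near δ k′ u → v (k K.- k′) ≤ₘ γ
        close {k} {k′} (u , u∈V , k-near) (u′ , u′∈V , k′-near) = ^ₘ-cancel-≤ e e≥1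
          (subst (_≤ₘ γ ^ₘ e) (w-ι _) (*ₘ-cancelʳ-≤ (w e₀) (w-≉0 e₀≉0)
            (subst (_≤ₘ δ) (v-* _ e₀) (≤ₘ-trans (coordinate-≤ u∈V u′∈V)
              (w-triangle (≤ₘ-trans (w[x-y]≤w[y-x] _ x) k-near) k′-near)))))

      limit : ∃[ l ] ConvergesTo K.commutativeRing v 𝓕 l
      limit = complete 𝓕 𝓕-isFilter 𝓕-isCauchy

      l : K.Carrier
      l = proj₁ limit

      -- Take a good approximation with coordinate `k` close to `l`. Replacing `k` by `l` changes it
      -- by `ι (k - l) * e₀`, which is small as well.
      limit-approximable : ∀ γ → γ ≢ 0ₘ → ∃[ u ] V u × Near γ l u
      limit-approximable γ γ≢0 =
        -- `δ` bounds `w (ι (k - l))`, `η` bounds `v (k - l)`, closeness `θ` to `x` forces the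
        -- latter bound, and `ε` meets both `θ` and `γ`.
        let δ , δ≢0 , δwe₀≤γ    = *ₘ-approx {w e₀} γ≢0
            η , η≢0 , ηᵉ≤δ      = ^ₘ-approx e e≥1 δ≢0
            θ , θ≢0 , near⇒≤η   = toWitness (proj₂ limit η η≢0)
            ε , ε≢0 , ε≤γ , ε≤θ = common γ≢0 θ≢0
            k , u , u∈V , k-near = near ε ε≢0
        in u , u∈V , w-triangle (≤ₘ-trans k-near ε≤γ) (w-cong-≤
             (≈-trans (ι[k-k′]x≈ k l e₀) (≈-sym ([x+u]-[y+u]≈x-y _ _ u)))
             (subst (_≤ₘ γ) (sym (v-* _ e₀)) (≤ₘ-trans
               (*ₘ-mono-≤ (subst (_≤ₘ δ) (sym (w-ι _))
                 (≤ₘ-trans (^ₘ-mono-≤ e (near⇒≤η u∈V (≤ₘ-trans k-near ε≤θ))) ηᵉ≤δ))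
                 (≤ₘ-refl {x = w e₀}))
               δwe₀≤γ)))

      -- A best approximation in `V` to `x - ι l * e₀` has an error below every nonzero `γ`, so the
      -- error is zero and `x` itself lies in `V+Ke₀`.
      limit-best : ∃[ z ] BestApproximation V+Ke₀ x z
      limit-best with u , u∈V , u-best ← proximinal (x - ι l * e₀) =
        ι l * e₀ + u , (l , u , u∈V , ≈-refl) , λ _ → ≤ₘ-trans (≤ₘ-reflexive x-z≡0) (⊥₋≤ _)
        where
        x-z≡0 : w (x - (ι l * e₀ + u)) ≡ 0ₘ
        x-z≡0 = all-≤⇒≡0ₘ λ γ γ≢0 → let u′ , u′∈V , l-near = limit-approximable γ γ≢0 in
          w-cong-≤ (x-y-z≈x-[y+z] x (ι l * e₀) u) (≤ₘ-trans (u-best u′∈V)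
            (w-cong-≤ (≈-sym (x-y-z≈x-[y+z] x (ι l * e₀) u′)) l-near))

    -- Either the distances from `x` have a nonzero strict lower bound, and discreteness makes their
    -- minimum attained, or `x` is approximable arbitrarily well and completeness of `K` applies
    -- through `Limit`.
    V+Ke₀-proximinal : Proximinal V+Ke₀
    V+Ke₀-proximinal x with em {P = e₀ ≈ 0#}
    ... | yes e₀≈0 with u , u∈V , u-best ← proximinal x =
      u , V⊆V+Ke₀ u∈V , λ z∈ → u-best (e₀≈0⇒V+Ke₀⊆V e₀≈0 z∈)
    ... | no e₀≉0 with em {P = ∃[ γ ] γ ≢ 0ₘ × (∀ (z : ∃[ z ] V+Ke₀ z) → ¬ w (x - proj₁ z) ≤ₘ γ)}
    ...   | yes (γ , γ≢0 , far) =
      let (z , z∈) , z-best = minimum em (λ z → w (x - proj₁ z)) (0# , V⊆V+Ke₀ 0∈) γ γ≢0 far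
      in z , z∈ , λ z′∈ → z-best (_ , z′∈)
    ...   | no ¬far = Limit.limit-best e₀≉0 x λ γ γ≢0 → decidable-stable em λ ¬near →
      ¬far (γ , γ≢0 , λ { (z , z∈) z-near → ¬near (z , z∈ , z-near) })

    V+Ke₀-noetherian : Noetherian V+Ke₀
    V+Ke₀-noetherian y y∈ y≤1 with em {P = e₀ ≈ 0#}
    ... | yes e₀≈0 = noetherian y (λ n → e₀≈0⇒V+Ke₀⊆V e₀≈0 (y∈ n)) y≤1
    ... | no e₀≉0 = let n , closure = noetherian y′ y′∈V y′≤1 in
        -- The reduced sequence starts just after the pivot `j`, so this index exceeds `j` and the
        -- index behind every `y′ i` with `i < n`. Undoing the reduction therefore uses preceding
        -- terms only.
        ℕ.suc (j ℕ.+ n) , λ S isSubmodule S-prev →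
          let open IsSubmodule isSubmodule renaming (resp to S-resp; +-closed to S-+; ι-closed to S-ι)
              y′ⱼ : ∀ q → v q ≤ₘ 1ₘ → S (ι q * y j)
              y′ⱼ q vq≤1 = S-ι q vq≤1 (S-prev j (s≤s (ℕₚ.m≤m+n j n)))
              y′∈S = closure S isSubmodule λ i i<n →
                S-+ (S-prev _ (s≤s (ℕₚ.+-monoʳ-< j i<n))) (y′ⱼ (r i) (vr≤1 i))
          in S-resp (y≈ n) (S-+ y′∈S (y′ⱼ (K.- r n) (≤ₘ-trans (KV.w[-x]≤w[x] (r n)) (vr≤1 n))))
      where
      k : ℕ → K.Carrier
      k n = proj₁ (y∈ n)
      u : ℕ → Carrier
      u n = proj₁ (proj₂ (y∈ n))
      u∈V : ∀ n → V (u n)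
      u∈V n = proj₁ (proj₂ (proj₂ (y∈ n)))
      y≈ku : ∀ n → y n ≈ ι (k n) * e₀ + u n
      y≈ku n = proj₂ (proj₂ (proj₂ (y∈ n)))

      -- By orthogonality the `e₀`-part of `y n` has value at most `w (y n)`, hence at most `1ₘ`.
      leading : ∃[ j ] (∀ n → w (ι (k n) * e₀) ≤ₘ w (ι (k j) * e₀))
      leading = maximum em (λ n → w (ι (k n) * e₀)) 0
        λ n → ≤ₘ-trans (orthogonal (k n) (u∈V n)) (w-cong-≤ (y≈ku n) (y≤1 n))

      j : ℕ
      j = proj₁ leading

      vk≤vkⱼ : ∀ n → v (k n) ≤ₘ v (k j)
      vk≤vkⱼ n = ^ₘ-cancel-≤ e e≥1 (subst₂ _≤ₘ_ (w-ι _) (w-ι _)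
        (*ₘ-cancelʳ-≤ (w e₀) (w-≉0 e₀≉0) (subst₂ _≤ₘ_ (v-* _ e₀) (v-* _ e₀) (proj₂ leading n))))

      -- The sign is chosen so that adding `ι (r i) * y j` kills the `e₀`-coordinate; maximality of
      -- the pivot puts `r i` in `K°`.
      quotient : ∀ i → ∃[ r ] v r ≤ₘ 1ₘ × K.- k (ℕ.suc (j ℕ.+ i)) K.≈ r K.* k j
      quotient i = KV.≤⇒divides (≤ₘ-trans (KV.w[-x]≤w[x] _) (vk≤vkⱼ _))

      r : ℕ → K.Carrier
      r i = proj₁ (quotient i)
      vr≤1 : ∀ i → v (r i) ≤ₘ 1ₘ
      vr≤1 i = proj₁ (proj₂ (quotient i))

      y′ : ℕ → Carrier
      y′ i = y (ℕ.suc (j ℕ.+ i)) + ι (r i) * y j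

      y′≤1 : ∀ i → w (y′ i) ≤ₘ 1ₘ
      y′≤1 i = w-+-≤ (y≤1 _) (w-*-≤1 (v≤1⇒wι≤1 (vr≤1 i)) (y≤1 j))

      k+rkⱼ≈0 : ∀ i → k (ℕ.suc (j ℕ.+ i)) K.+ r i K.* k j K.≈ K.0#
      k+rkⱼ≈0 i = K.trans (K.+-congˡ (K.sym (proj₂ (proj₂ (quotient i))))) (K.-‿inverseʳ _)

      y′∈V : ∀ i → V (y′ i)
      y′∈V i = resp (≈-sym y′≈) (+-closed (u∈V _) (ι-closed (r i) (u∈V j)))
        where
        n = ℕ.suc (j ℕ.+ i)
        y′≈ : y′ i ≈ u n + ι (r i) * u j
        y′≈ = begin
          y n + ι (r i) * y j
            ≈⟨ +-cong (y≈ku n) (*-congˡ (y≈ku j)) ⟩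
          (ι (k n) * e₀ + u n) + ι (r i) * (ι (k j) * e₀ + u j)
            ≈⟨ +-congˡ (distribˡ (ι (r i)) _ _) ⟩
          (ι (k n) * e₀ + u n) + (ι (r i) * (ι (k j) * e₀) + ι (r i) * u j)
            ≈⟨ interchange _ _ _ _ ⟩
          (ι (k n) * e₀ + ι (r i) * (ι (k j) * e₀)) + (u n + ι (r i) * u j)
            ≈⟨ +-congʳ (+-congˡ (*-assoc _ _ e₀)) ⟨
          (ι (k n) * e₀ + ι (r i) * ι (k j) * e₀) + (u n + ι (r i) * u j)
            ≈⟨ +-congʳ (distribʳ e₀ _ _) ⟨
          (ι (k n) + ι (r i) * ι (k j)) * e₀ + (u n + ι (r i) * u j)
            ≈⟨ +-congʳ (*-congʳ (≈-trans (ι.+-homo _ _) (+-congˡ (ι.*-homo (r i) (k j))))) ⟨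
          ι (k n K.+ r i K.* k j) * e₀ + (u n + ι (r i) * u j)
            ≈⟨ +-congʳ (*-congʳ (≈-trans (ι.⟦⟧-cong (k+rkⱼ≈0 i)) ι.0#-homo)) ⟩
          0# * e₀ + (u n + ι (r i) * u j)
            ≈⟨ +-congʳ (zeroˡ e₀) ⟩
          0# + (u n + ι (r i) * u j)
            ≈⟨ +-identityˡ _ ⟩
          u n + ι (r i) * u j ∎

      y≈ : ∀ i → y′ i + ι (K.- r i) * y j ≈ y (ℕ.suc (j ℕ.+ i))
      y≈ i = begin
        y′ i + ι (K.- r i) * y j   ≈⟨ +-congˡ (*-congʳ (ι.-‿homo (r i))) ⟩
        y′ i + - ι (r i) * y j     ≈⟨ +-congˡ (-‿distribˡ-* (ι (r i)) (y j)) ⟨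
        y′ i - ι (r i) * y j       ≈⟨ x+y-y≈x _ _ ⟩
        y (ℕ.suc (j ℕ.+ i))        ∎

  -- Induction on a spanning family.

  record IsGood (V : Pred Carrier (c ⊔ c′ ⊔ ℓ′)) : Set (suc c ⊔ c′ ⊔ suc ℓ′) where
    field
      subspace   : IsSubspace V
      proximinal : Proximinal V
      noetherian : Noetherian V

  zero-isGood : IsGood (λ x → Lift (c ⊔ c′) (x ≈ 0#))
  zero-isGood = record
    { subspace   = record
      { resp     = λ x≈y (lift x≈0) → lift (≈-trans (≈-sym x≈y) x≈0)
      ; 0∈       = lift ≈-refl
      ; +-closed = λ (lift x≈0) (lift y≈0) → lift (≈-trans (+-cong x≈0 y≈0) (+-identityˡ 0#))
      ; ι-closed = λ k (lift x≈0) → lift (≈-trans (*-congˡ x≈0) (zeroʳ (ι k)))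
      }
    ; proximinal = λ x → 0# , lift ≈-refl ,
        λ (lift u≈0) → ≤ₘ-reflexive (v-cong (+-congˡ (-‿cong (≈-sym u≈0))))
    -- Already the first term is zero, hence in the span of no terms.
    ; noetherian = λ y y∈ _ → 0 , λ S isSubmodule _ →
        let open IsSubmodule isSubmodule in resp (≈-sym (lower (y∈ 0))) 0∈
    }

  infixr 7 _∙_
  _∙_ : ∀ {n} → Vector K.Carrier n → Vector Carrier n → Carrier
  k ∙ b = sum (λ i → ι (k i) * b i)

  -- Each new vector is replaced by its difference from a best approximation in the space built so
  -- far, which makes it orthogonal to that space.
  finite-span : ∀ {n} (b : Vector Carrier n) → ∃[ V ] IsGood V × (∀ k → V (k ∙ b))
  finite-span {ℕ.zero}  b = _ , zero-isGood , λ _ → lift ≈-refl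
  finite-span {ℕ.suc n} b with V , good , span ← finite-span (tail b) = V+Ke₀ ,
      record
        { subspace   = V+Ke₀-isSubspace
        ; proximinal = V+Ke₀-proximinal
        ; noetherian = V+Ke₀-noetherian
        } ,
      λ k → head k , _ , +-closed (ι-closed (head k) u∈V) (span (tail k)) , (begin
        ι (head k) * head b + tail k ∙ tail b                ≈⟨ +-congʳ (*-congˡ (x-y+y≈x u (head b))) ⟨
        ι (head k) * (e₀ + u) + tail k ∙ tail b              ≈⟨ +-congʳ (distribˡ _ e₀ u) ⟩
        ι (head k) * e₀ + ι (head k) * u + tail k ∙ tail b   ≈⟨ +-assoc _ _ _ ⟩
        ι (head k) * e₀ + (ι (head k) * u + tail k ∙ tail b) ∎)
    where
    open IsGood good
    open IsSubspace subspace
    u = proj₁ (proximinal (head b))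
    u∈V = proj₁ (proj₂ (proximinal (head b)))
    u-best = proj₂ (proj₂ (proximinal (head b)))
    e₀ = head b - u

    -- `e₀ + u′` is the error of the competing approximation `u - u′` to `head b`.
    e₀⊥V : ∀ {u′} → V u′ → w e₀ ≤ₘ w (e₀ + u′)
    e₀⊥V {u′} u′∈V = subst (w e₀ ≤ₘ_) (v-cong (begin
      head b - (u - u′)  ≈⟨ x-y-z≈x-[y+z] _ _ _ ⟨
      head b - u - - u′  ≈⟨ +-congˡ (-‿involutive u′) ⟩
      e₀ + u′            ∎)) (u-best (+-closed u∈V (neg-closed u′∈V)))

    open Adjoin subspace proximinal noetherian e₀ e₀⊥V

  -- Spans over `K°` and integral equations.

  K°-Span : ∀ {n} → Vector Carrier n → Pred Carrier (c ⊔ ℓ′)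
  K°-Span {n} y x = Σ[ k ∈ Vector K.Carrier n ] (∀ i → v (k i) ≤ₘ 1ₘ) × x ≈ k ∙ y

  K°-Span-isSubmodule : ∀ {n} (y : Vector Carrier n) → IsSubmodule (K°-Span y)
  K°-Span-isSubmodule {n} y = record
    { resp     = λ { x≈x′ (k , vk≤1 , x≈) → k , vk≤1 , ≈-trans (≈-sym x≈x′) x≈ }
    ; 0∈       = (λ _ → K.0#) , (λ _ → KV.w-≈0-≤ K.refl) ,
        ≈-sym (≈-trans (sum-cong-≋ (λ i → 0y≈0 (y i))) (sum-replicate-zero n))
    ; +-closed = λ { (k , vk≤1 , x≈) (k′ , vk′≤1 , x′≈) →
        (λ i → k i K.+ k′ i) , (λ i → KV.w-+-≤ (vk≤1 i) (vk′≤1 i)) ,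
        ≈-trans (+-cong x≈ x′≈) (≈-trans (≈-sym (∑-distrib-+ {n} _ _))
          (sum-cong-≋ (λ i → ≈-trans (≈-sym (distribʳ (y i) _ _)) (*-congʳ (≈-sym (ι.+-homo _ _)))))) }
    ; ι-closed = λ { q vq≤1 (k , vk≤1 , x≈) →
        (λ i → q K.* k i) , (λ i → KV.w-*-≤1 vq≤1 (vk≤1 i)) ,
        ≈-trans (*-congˡ x≈) (≈-trans (*-distribˡ-sum {n} (ι q) _)
          (sum-cong-≋ (λ i → ≈-trans (≈-sym (*-assoc _ _ (y i))) (*-congʳ (≈-sym (ι.*-homo _ _)))))) }
    }
    where
    0y≈0 : ∀ y → ι K.0# * y ≈ 0#
    0y≈0 y = ≈-trans (*-congʳ ι.0#-homo) (zeroˡ y)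

  ∈-K°-Span : ∀ {n} (y : Vector Carrier n) i → K°-Span y (y i)
  ∈-K°-Span y Fin.zero with k , vk≤1 , 0≈ ← IsSubmodule.0∈ (K°-Span-isSubmodule (tail y)) =
    (λ { Fin.zero → K.1# ; (Fin.suc i) → k i }) ,
    (λ { Fin.zero → ≤ₘ-reflexive KV.v-1 ; (Fin.suc i) → vk≤1 i }) ,
    ≈-sym (≈-trans (+-cong (≈-trans (*-congʳ ι.1#-homo) (*-identityˡ _)) (≈-sym 0≈)) (+-identityʳ _))
  ∈-K°-Span y (Fin.suc i) with k , vk≤1 , yi≈ ← ∈-K°-Span (tail y) i =
    (λ { Fin.zero → K.0# ; (Fin.suc i) → k i }) ,
    (λ { Fin.zero → KV.w-≈0-≤ K.refl ; (Fin.suc i) → vk≤1 i }) ,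
    ≈-sym (≈-trans (+-cong (≈-trans (*-congʳ ι.0#-homo) (zeroˡ _)) (≈-sym yi≈)) (+-identityˡ _))

  -- The powers of `x` stay in the unit ball, so some `x ^ n` is a `K°`-combination of the lower
  -- powers.
  w≤1⇒integral : ∀ {m} (b : Vector Carrier m) → (∀ x → ∃[ k ] x ≈ k ∙ b) → ∀ x → w x ≤ₘ 1ₘ →
    ∃[ n ] Σ[ k ∈ Vector K.Carrier n ] (∀ i → v (k i) ≤ₘ 1ₘ) × x ^ n + k ∙ (λ i → x ^ toℕ i) ≈ 0#
  w≤1⇒integral b spans x wx≤1 =
    let V , good , span = finite-span b
        open IsGood good
        n , closure = noetherian (x ^_)
          (λ n → let k , xⁿ≈ = spans (x ^ n) in IsSubspace.resp subspace (≈-sym xⁿ≈) (span k)) w^≤1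
        powers = λ (i : Fin n) → x ^ toℕ i
        open IsSubmodule (K°-Span-isSubmodule powers)
        -- Expanding `- (x ^ n)` rather than `x ^ n` gives the coefficients of the monic equation
        -- with the right sign.
        k , vk≤1 , -xⁿ≈ = resp (ι[-1]x≈-x _) (ι-closed (K.- K.1#)
          (≤ₘ-trans (KV.w[-x]≤w[x] K.1#) (≤ₘ-reflexive KV.v-1))
          (closure (K°-Span powers) (K°-Span-isSubmodule powers)
            λ i i<n → subst (λ j → K°-Span powers (x ^ j)) (toℕ-fromℕ< i<n)
              (∈-K°-Span powers (fromℕ< i<n))))
    in n , k , vk≤1 , ≈-trans (+-congˡ (≈-sym -xⁿ≈)) (-‿inverseʳ _)
    where
    w^≤1 : ∀ n → w (x ^ n) ≤ₘ 1ₘ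
    w^≤1 ℕ.zero    = ≤ₘ-reflexive v-1
    w^≤1 (ℕ.suc n) = w-*-≤1 wx≤1 (w^≤1 n)

-- Transfer to the integral closure and conclusion.

≐-isSubring : ∀ {c ℓ q} (R : CommutativeRing c ℓ) {P : Pred (CommutativeRing.Carrier R) p}
              {Q : Pred (CommutativeRing.Carrier R) q} → P ≐ Q → IsSubring R Q → IsSubring R P
≐-isSubring R (P⊆Q , Q⊆P) isSubring = record
  { resp       = λ x≈y x∈P → Q⊆P (resp x≈y (P⊆Q x∈P))
  ; 0∈         = Q⊆P 0∈
  ; 1∈         = Q⊆P 1∈
  ; +-closed   = λ x∈P y∈P → Q⊆P (+-closed (P⊆Q x∈P) (P⊆Q y∈P))
  ; *-closed   = λ x∈P y∈P → Q⊆P (*-closed (P⊆Q x∈P) (P⊆Q y∈P))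
  ; neg-closed = λ x∈P → Q⊆P (neg-closed (P⊆Q x∈P))
  }
  where open IsSubring isSubring

mainTheorem7 :
    (∀ {a} → ExcludedMiddle a) →
    ∀ {c ℓ c′ ℓ′} (K : Field c ℓ) (L : Field c′ ℓ′) →
    let module K = Field K
        module L = Field L
    in
    (v : K.Carrier → ℤₘ₀) (v-disc : IsDiscreteValuation K.commutativeRing v) →
    IsComplete K.commutativeRing v →
    (ι : K.Carrier → L.Carrier) → IsFiniteExtension K L ι →
    (w : L.Carrier → ℤₘ₀) → IsDiscreteValuation L.commutativeRing w →
    Extends ι v w →
    let K° = unitBallRing K.commutativeRing (IsDiscreteValuation.isValuation v-disc)
        integralClosure = IntegralClosure K° L.commutativeRing (ι ∘ proj₁)
    in
    (integralClosure ≐ UnitBall L.commutativeRing w) ×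
    (Σ[ isSubring ∈ IsSubring L.commutativeRing integralClosure ]
       IsDiscreteValuationRing (subring L.commutativeRing isSubring))
mainTheorem7 em K L v v-disc complete ι finite w w-disc (e , e≥1 , w-ι) =
  closure≐ball , isSubring ,
  DiscreteValuationRing.isDiscreteValuationRing em L w w-disc closure≐ball isSubring
  where
  module L = Field L
  open IsFiniteExtension finite renaming (finite to spanning)
  w-isV = IsDiscreteValuation.isValuation w-disc
  v-isV = IsDiscreteValuation.isValuation v-disc
  open FiniteExtension em K L v v-isV complete ι isRingHomomorphism w w-isV e e≥1 w-ι

  closure≐ball :
    IntegralClosure (unitBallRing (Field.commutativeRing K) v-isV) L.commutativeRing (ι ∘ proj₁)
      ≐ UnitBall L.commutativeRing w
  closure≐ball =
    (λ { {x} (n , k , eq) → integral⇒w≤1 x n (proj₁ ∘ k) (proj₂ ∘ k) eq }) ,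
    (λ { {x} wx≤1 →
      let _ , b , spans = spanning
          n , k , vk≤1 , eq = w≤1⇒integral b spans x wx≤1
      in n , (λ i → k i , vk≤1 i) , eq })

  -- Closure of integral elements under sums and products is inherited from the unit ball.
  isSubring = ≐-isSubring L.commutativeRing closure≐ball (unitBall-isSubring L.commutativeRing w-isV)
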